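{- For any set $\Gamma\subseteq\mathcal{L}^-$, if $\Gamma$ is consistent (with respect to $\mathbf{ELCR}^-$), then $\Gamma$ is satisfiable, i.e., there are a $k$-sight model $M=(\mathbf{D},\mathbf{I},\Sigma,\sim)$ and $\sigma\in\Sigma$ with $M,\sigma\models\varphi$ for all $\varphi\in\Gamma$. As a consequence, $\mathsf{ELCR}^-$ is compact: a set of $\mathcal{L}^-$-formulas is satisfiable whenever each of its finite subsets is.
   Context: Fix a natural number $k$ and a vocabulary: $Pred$ (predicate symbols with arities, containing binary $R$), a nonempty finite set $Cons$ of constants, $Var=\{x,y\}$; terms $\mathsf{Term}=Cons\cup Var$. $\mathcal{L}_{\mathsf{B}}$: $\alpha::=P(t_1,\dots,t_m)\mid t_1\equiv t_2\mid\neg\alpha\mid(\alpha\land\alpha)$. $\mathcal{L}^-$: $\varphi::=\alpha\mid K_zt\mid\neg\varphi\mid(\varphi\land\varphi)\mid K_z\alpha$ with $\alpha\in\mathcal{L}_{\mathsf{B}}$, $z\in Var$, $t\in\mathsf{Term}$. $\langle K_z\rangle\beta:=\neg K_z\neg\beta$; $K_z\mathcal{T}:=\bigwedge_{t\in\mathcal{T}}K_zt$; $\alpha[t_1/t_2]$ replaces every occurrence of $t_2$ in $\alpha$ by $t_1$; $\mathsf{D}^0t_1t_2:=t_1\equiv t_2$, $\mathsf{D}^{n+1}t_1t_2:=\mathsf{D}^nt_1t_2\lor\bigvee_{t\in\mathsf{Term}}(\mathsf{D}^nt_1t\land(Rtt_2\lor Rt_2t))$; for $\mathcal{T}\subseteq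 Cons$, $K_zz'=\mathcal{T}:=\bigwedge_{c\in\mathcal{T}}\langle K_z\rangle z'\equiv c\land\bigwedge_{c\in Cons\setminus\mathcal{T}}K_z\neg z'\equiv c$. Models: $M=(\mathbf{D},\mathbf{I},\Sigma,\sim)$ with $\mathbf{D}$ nonempty finite; $\mathbf{I}(P)\subseteq\mathbf{D}^m$ for $m$-ary $P$, $\mathbf{R}:=\mathbf{I}(R)$ serial; $\mathbf{I}(c)\in\mathbf{D}$ for $c\in Cons$, every element of $\mathbf{D}$ named by some constant; $\Sigma\subseteq\mathbf{D}^{Var}$ nonempty (situations); $\sim_x,\sim_y$ equivalence relations on $\Sigma$. $\mathbb{D}^0(s)=\{s\}$, $\mathbb{D}^{m+1}(s)=\mathbb{D}^m(s)\cup\{t:\exists u\in\mathbb{D}^m(s),(u,t)\in\mathbf{R}\text{ or }(t,u)\in\mathbf{R}\}$. $M$ is $k$-sight if $\sigma\sim_z\sigma'$ implies $\sigma(z')=\sigma'(z')$ for every $z'\in Var$ with $\sigma(z')\in\mathbb{D}^k(\sigma(z))$. Semantics: $t^{(\mathbf{I},\sigma)}$ is $\mathbf{I}(t)$ or $\sigma(t)$; $P(t_1,\dots,t_m)$ true iff the tuple of values is in $\mathbf{I}(P)$; $t_1\equiv t_2$ iff equal values; Boolean standard; $K_zt$ true at $\sigma$ iff $t$ has the same value at all $\sigma'\in\Sigma$ with $\sigma'\sim_z\sigma$; $K_z\varphi$ true at $\sigma$ iff $\varphi$ true at all $\sigma'\in\Sigma$ with $\sigma'\sim_z\sigma$. $\mathbf{ELCR}^-$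 has axioms and rules (with $z,z'\in Var$, $t,t_i\in\mathsf{Term}$, $c\in Cons$): (Tau) propositional tautologies; (A1) $t_1\equiv t_1$; (A2) $t_1\equiv t_2\to t_2\equiv t_1$; (A3) $t_1\equiv t_2\land t_2\equiv t_3\to t_1\equiv t_3$; (A4) $t_1\equiv t_2\to(\alpha\leftrightarrow\alpha[t_1/t_2])$ for $\alpha\in\mathcal{L}_{\mathsf{B}}$; (MP) from $\varphi\to\psi$ and $\varphi$ infer $\psi$; (Seriality) $\bigvee_{t\in Cons}Rct$; (At-Some-Where) $\bigvee_{c\in Cons}z\equiv c$; ($k$-sight) $\mathsf{D}^kzt\to K_zt$; (K) $K_z(\alpha\to\beta)\to(K_z\alpha\to K_z\beta)$, $\alpha,\beta\in\mathcal{L}_{\mathsf{B}}$; (T) $K_z\alpha\to\alpha$, $\alpha\in\mathcal{L}_{\mathsf{B}}$; (Knowledge-Ground) $K_zz'=\mathcal{T}\to(K_z\alpha\leftrightarrow\bigwedge_{c\in\mathcal{T}}\alpha[c/z'])$ for $\mathcal{T}\subseteq Cons$, $\{z,z'\}=\{x,y\}$, $\alpha\in\mathcal{L}_{\mathsf{B}}$; (K-Additivity) from $\varphi\to\alpha$ infer $\varphi\to K_z\alpha$, where $\varphi=K_z\alpha_1\land\dots\land K_z\alpha_n\land\langle K_z\rangle\beta_1\land\dots\land\langle K_z\rangle\beta_m$, $1\le m+n$, $\alpha,\alpha_i,\beta_j\in\mathcal{L}_{\mathsf{B}}$; (K-Elimination) from $\varphi\to(K_z\alpha\to\beta)$ infer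 $\varphi\to(\alpha\to\beta)$, where $\varphi=K_{z'}\alpha_1\land\dots\land K_{z'}\alpha_n\land\langle K_{z'}\rangle\beta_1\land\dots\land\langle K_{z'}\rangle\beta_m$, $1\le m+n$, $\alpha,\beta,\alpha_i,\beta_j\in\mathcal{L}_{\mathsf{B}}$, $\{z,z'\}=\{x,y\}$; (De-Re-Knowledge) $t\equiv c\to(K_zt\leftrightarrow K_zt\equiv c)$; (Structure-Knowledge) $(K_z\mathcal{T}\land\alpha)\to K_z\alpha$ for $\alpha\in\mathcal{L}_{\mathsf{B}}$ all of whose terms lie in $\mathcal{T}\subseteq\mathsf{Term}$. $\vdash\varphi$ means $\varphi$ is derivable. A set $\Delta$ is inconsistent if $\vdash\bigwedge\Gamma_0\to\bot$ for some finite $\Gamma_0\subseteq\Delta$, and consistent otherwise. -}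

module Defs where

open import Data.Bool.Base using (Bool; true; false; not; T; if_then_else_) renaming (_∧_ to _∧ᵇ_)
open import Data.Fin.Base using (Fin)
open import Data.Fin.Properties using () renaming (_≟_ to _≟ᶠ_)
open import Data.List.Base using (List; []; _∷_; _++_; map; foldr; length; filterᵇ; allFin)
open import Data.List.Membership.Propositional using () renaming (_∈_ to _∈ˡ_)
open import Data.List.Relation.Unary.All using (All)
open import Data.Nat.Base using (ℕ; zero; suc; _+_; _≤_)
open import Data.Product.Base using (Σ; ∃-syntax; _×_; _,_; proj₁; proj₂)
open import Data.Sum.Base using (_⊎_)
open import Data.Vec.Base as Vec using (Vec; []; _∷_)
open import Data.Vec.Relation.Unary.All using () renaming (All to Allᵛ)
open import Function.Base using (_∘_; _on_)
open import Function.Bundles using (_↔_; Inverse)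
open import Function.Definitions using (StrictlySurjective)
open import Function.Properties.Inverse using (↔⇒↣)
open import Level using (0ℓ)
open import Relation.Binary.Core using (Rel)
open import Relation.Binary.Definitions using (DecidableEquality)
open import Relation.Binary.PropositionalEquality.Core using (_≡_; _≢_; refl; cong)
open import Relation.Binary.Structures using (IsEquivalence)
open import Relation.Nullary.Decidable using (yes; no; does; map′; via-injection)
open import Relation.Nullary.Negation.Core using (¬_)
open import Relation.Unary using (Pred; _∈_)

NonemptyFinite : Set → Set
NonemptyFinite A = ∃[ n ] (A ↔ Fin (suc n))

-- Predicate symbols are indexed by their arity.
record Vocabulary : Set₁ where
  field
    PredSym     : ℕ → Set
    R           : PredSym 2
    Cons        : Set
    cons-finite : NonemptyFinite Cons

module ELCR (V : Vocabulary) where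
  open Vocabulary V

  data Var : Set where
    x y : Var

  data Term : Set where
    con : Cons → Term
    var : Var → Term

  constants : List Cons
  constants = map (Inverse.from (proj₂ cons-finite)) (allFin _)

  terms : List Term
  terms = var x ∷ var y ∷ map con constants

  _≟ᶜ_ : DecidableEquality Cons
  _≟ᶜ_ = via-injection (↔⇒↣ (proj₂ cons-finite)) _≟ᶠ_

  _≟ᵗ_ : DecidableEquality Term
  con c ≟ᵗ con d = map′ (cong con) (λ { refl → refl }) (c ≟ᶜ d)
  con c ≟ᵗ var z = no λ ()
  var z ≟ᵗ con c = no λ ()
  var x ≟ᵗ var x = yes refl
  var x ≟ᵗ var y = no λ ()
  var y ≟ᵗ var x = no λ ()
  var y ≟ᵗ var y = yes refl

  data Language : Set where
    basic epistemic : Language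

  infix  9 _≐_
  infix  8 ~_
  infixr 7 _∧_

  -- Both languages are carved out of one family, so that a Boolean
  -- combination of basic formulas is a single formula of the epistemic
  -- language, not one copy as a basic formula and another as an epistemic
  -- one.
  data Formula : Language → Set where
    pred : ∀ {ℓ m} → PredSym m → Vec Term m → Formula ℓ
    _≐_  : ∀ {ℓ} → Term → Term → Formula ℓ
    ~_   : ∀ {ℓ} → Formula ℓ → Formula ℓ
    _∧_  : ∀ {ℓ} → Formula ℓ → Formula ℓ → Formula ℓ
    Kv   : Var → Term → Formula epistemic
    K    : Var → Formula basic → Formula epistemic

  Lᴮ L⁻ : Set
  Lᴮ = Formula basic
  L⁻ = Formula epistemic

  ⌜_⌝ : Lᴮ → L⁻
  ⌜ pred P ts ⌝ = pred P ts
  ⌜ t ≐ u ⌝     = t ≐ u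
  ⌜ ~ α ⌝       = ~ ⌜ α ⌝
  ⌜ α ∧ β ⌝     = ⌜ α ⌝ ∧ ⌜ β ⌝

  module _ {ℓ : Language} where

    infixr 6 _∨_
    infixr 5 _⇒_
    infix  4 _⇔_

    _∨_ _⇒_ _⇔_ : Formula ℓ → Formula ℓ → Formula ℓ
    φ ∨ ψ = ~ (~ φ ∧ ~ ψ)
    φ ⇒ ψ = ~ (φ ∧ ~ ψ)
    φ ⇔ ψ = (φ ⇒ ψ) ∧ (ψ ⇒ φ)

    -- A propositional contradiction; which one is immaterial.
    ⊥ᶠ ⊤ᶠ : Formula ℓ
    ⊥ᶠ = var x ≐ var x ∧ ~ (var x ≐ var x)
    ⊤ᶠ = ~ ⊥ᶠ

    ⋀ ⋁ : List (Formula ℓ) → Formula ℓ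
    ⋀ = foldr _∧_ ⊤ᶠ
    ⋁ = foldr _∨_ ⊥ᶠ

    Rᶠ : Term → Term → Formula ℓ
    Rᶠ t u = pred R (t ∷ u ∷ [])

    Dᶠ : ℕ → Term → Term → Formula ℓ
    Dᶠ zero    t₁ t₂ = t₁ ≐ t₂
    Dᶠ (suc n) t₁ t₂ = Dᶠ n t₁ t₂ ∨ ⋁ (map (λ t → Dᶠ n t₁ t ∧ (Rᶠ t t₂ ∨ Rᶠ t₂ t)) terms)

  ⟨K⟩ : Var → Lᴮ → L⁻
  ⟨K⟩ z β = ~ K z (~ β)

  -- Sets of terms and of constants are given by characteristic functions.
  KvAll : Var → (Term → Bool) → L⁻
  KvAll z 𝒯 = ⋀ (map (Kv z) (filterᵇ 𝒯 terms))

  -- The formula written K_z z' = 𝒯.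
  Range : Var → Var → (Cons → Bool) → L⁻
  Range z z′ 𝒯 =
    ⋀ (map (λ c → ⟨K⟩ z (var z′ ≐ con c)) (filterᵇ 𝒯 constants)) ∧
    ⋀ (map (λ c → K z (~ (var z′ ≐ con c))) (filterᵇ (not ∘ 𝒯) constants))

  Modal : Var → List Lᴮ → List Lᴮ → L⁻
  Modal z αs βs = ⋀ (map (K z) αs ++ map (⟨K⟩ z) βs)

  replace : Term → Term → Term → Term
  replace t₁ t₂ t = if does (t ≟ᵗ t₂) then t₁ else t

  -- α [ t₁ / t₂ ] puts t₁ for every occurrence of t₂.
  infix 10 _[_/_]
  _[_/_] : Lᴮ → Term → Term → Lᴮ
  pred P ts [ t₁ / t₂ ] = pred P (Vec.map (replace t₁ t₂) ts)
  (t ≐ u)   [ t₁ / t₂ ] = replace t₁ t₂ t ≐ replace t₁ t₂ u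
  (~ α)     [ t₁ / t₂ ] = ~ (α [ t₁ / t₂ ])
  (α ∧ β)   [ t₁ / t₂ ] = α [ t₁ / t₂ ] ∧ β [ t₁ / t₂ ]

  TermsIn : (Term → Bool) → Lᴮ → Set
  TermsIn 𝒯 (pred P ts) = Allᵛ (T ∘ 𝒯) ts
  TermsIn 𝒯 (t ≐ u)     = T (𝒯 t) × T (𝒯 u)
  TermsIn 𝒯 (~ α)       = TermsIn 𝒯 α
  TermsIn 𝒯 (α ∧ β)     = TermsIn 𝒯 α × TermsIn 𝒯 β

  -- v supplies the truth values of the formulas that are neither a negation
  -- nor a conjunction; its other values are ignored.
  eval : (L⁻ → Bool) → L⁻ → Bool
  eval v (~ φ)   = not (eval v φ)
  eval v (φ ∧ ψ) = eval v φ ∧ᵇ eval v ψ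
  eval v φ       = v φ

  Tautology : L⁻ → Set
  Tautology φ = ∀ v → eval v φ ≡ true

  infix 3 _⊢_

  data _⊢_ (k : ℕ) : L⁻ → Set where
    Tau : ∀ φ → Tautology φ → k ⊢ φ
    A1  : ∀ t₁ → k ⊢ t₁ ≐ t₁
    A2  : ∀ t₁ t₂ → k ⊢ t₁ ≐ t₂ ⇒ t₂ ≐ t₁
    A3  : ∀ t₁ t₂ t₃ → k ⊢ t₁ ≐ t₂ ∧ t₂ ≐ t₃ ⇒ t₁ ≐ t₃
    A4  : ∀ t₁ t₂ α → k ⊢ t₁ ≐ t₂ ⇒ (⌜ α ⌝ ⇔ ⌜ α [ t₁ / t₂ ] ⌝)
    MP  : ∀ φ ψ → k ⊢ φ ⇒ ψ → k ⊢ φ → k ⊢ ψ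

    Seriality     : ∀ c → k ⊢ ⋁ (map (λ t → Rᶠ (con c) (con t)) constants)
    At-Some-Where : ∀ z → k ⊢ ⋁ (map (λ c → var z ≐ con c) constants)
    k-sight       : ∀ z t → k ⊢ Dᶠ k (var z) t ⇒ Kv z t

    K-axiom : ∀ z α β → k ⊢ K z (α ⇒ β) ⇒ (K z α ⇒ K z β)
    T-axiom : ∀ z α → k ⊢ K z α ⇒ ⌜ α ⌝

    Knowledge-Ground : ∀ z z′ → z ≢ z′ → ∀ 𝒯 α →
      k ⊢ Range z z′ 𝒯 ⇒
          (K z α ⇔ ⋀ (map (λ c → ⌜ α [ con c / var z′ ] ⌝) (filterᵇ 𝒯 constants)))

    K-Additivity : ∀ z αs βs → 1 ≤ length αs + length βs → ∀ α →
      k ⊢ Modal z αs βs ⇒ ⌜ α ⌝ →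
      k ⊢ Modal z αs βs ⇒ K z α

    K-Elimination : ∀ z z′ → z ≢ z′ → ∀ αs βs → 1 ≤ length αs + length βs → ∀ α β →
      k ⊢ Modal z′ αs βs ⇒ (K z α ⇒ ⌜ β ⌝) →
      k ⊢ Modal z′ αs βs ⇒ (⌜ α ⌝ ⇒ ⌜ β ⌝)

    De-Re-Knowledge : ∀ z t c → k ⊢ t ≐ con c ⇒ (Kv z t ⇔ K z (t ≐ con c))

    Structure-Knowledge : ∀ z 𝒯 α → TermsIn 𝒯 α →
      k ⊢ (KvAll z 𝒯 ∧ ⌜ α ⌝) ⇒ K z α

  Inconsistent : ℕ → Pred L⁻ 0ℓ → Set
  Inconsistent k Δ = ∃[ Γ₀ ] (All (_∈ Δ) Γ₀ × (k ⊢ ⋀ Γ₀ ⇒ ⊥ᶠ))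

  Consistent : ℕ → Pred L⁻ 0ℓ → Set
  Consistent k Δ = ¬ Inconsistent k Δ

  record Model : Set₁ where
    field
      D          : Set
      D-finite   : NonemptyFinite D
      I          : ∀ {m} → PredSym m → Pred (Vec D m) 0ℓ
      R-serial   : ∀ d → ∃[ e ] ((d ∷ e ∷ []) ∈ I R)
      Iᶜ         : Cons → D
      named      : StrictlySurjective _≡_ Iᶜ
      Sit        : Pred (Var → D) 0ℓ
      Sit-inhab  : ∃[ σ ] (σ ∈ Sit)
      -- Only the restriction of these relations to Sit matters.
      _∼[_]_     : (Var → D) → Var → (Var → D) → Set
      ∼-equiv    : ∀ z → IsEquivalence {A = Σ (Var → D) Sit} ((λ σ τ → σ ∼[ z ] τ) on proj₁)

    𝐑 : Rel D 0ℓ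
    𝐑 d e = (d ∷ e ∷ []) ∈ I R

    -- Near m s t says that t belongs to 𝔻ᵐ(s).
    Near : ℕ → D → D → Set
    Near zero    s t = t ≡ s
    Near (suc m) s t = Near m s t ⊎ (∃[ u ] (Near m s u × (𝐑 u t ⊎ 𝐑 t u)))

    value : (Var → D) → Term → D
    value σ (con c) = Iᶜ c
    value σ (var z) = σ z

  KSight : ℕ → Model → Set
  KSight k M = ∀ z {σ σ′} → σ ∈ Sit → σ′ ∈ Sit → σ ∼[ z ] σ′ →
               ∀ z′ → Near k (σ z) (σ z′) → σ z′ ≡ σ′ z′
    where open Model M

  infix 3 _,_⊨_

  _,_⊨_ : ∀ {ℓ} (M : Model) → (Var → Model.D M) → Formula ℓ → Set
  M , σ ⊨ pred P ts = Vec.map (value σ) ts ∈ I P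
    where open Model M
  M , σ ⊨ t ≐ u     = value σ t ≡ value σ u
    where open Model M
  M , σ ⊨ ~ φ       = ¬ (M , σ ⊨ φ)
  M , σ ⊨ φ ∧ ψ     = (M , σ ⊨ φ) × (M , σ ⊨ ψ)
  M , σ ⊨ Kv z t    = ∀ {σ′ σ″} → σ′ ∈ Sit → σ″ ∈ Sit → σ′ ∼[ z ] σ → σ″ ∼[ z ] σ →
                      value σ′ t ≡ value σ″ t
    where open Model M
  M , σ ⊨ K z α     = ∀ {σ′} → σ′ ∈ Sit → σ′ ∼[ z ] σ → M , σ′ ⊨ α
    where open Model M

  Satisfiable : ℕ → Pred L⁻ 0ℓ → Set₁
  Satisfiable k Γ = Σ Model λ M → KSight k M ×
    ∃[ σ ] (σ ∈ Model.Sit M × (∀ φ → φ ∈ Γ → M , σ ⊨ φ))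

  FinitelySatisfiable : ℕ → Pred L⁻ 0ℓ → Set₁
  FinitelySatisfiable k Γ = ∀ (Γ₀ : List L⁻) → All (_∈ Γ) Γ₀ → Satisfiable k (_∈ˡ Γ₀)

{-# OPTIONS --safe #-}

-- Extend Γ to a maximal consistent set H. The constants modulo provable
-- equality in H form the domain, A4 and At-Some-Where settle the basic formulas
-- at the actual situation σ₀, and Knowledge-Ground reduces K z α to the basic
-- formulas α [ con c / var z′ ] for the constants c that z considers possible.
-- Formulas do not nest K, so only the two classes of σ₀ matter. Compactness
-- follows by soundness.

module Submission where

open import Axiom.ExcludedMiddle using (ExcludedMiddle)
open import Axiom.Extensionality.Propositional using (Extensionality)
open import Data.Bool.Base using (Bool; true; false; not; T)
open import Data.Bool.Properties using (T-∧; T-≡; T?)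
open import Data.Empty using (⊥-elim)
open import Data.Fin.Base using (Fin; zero; suc)
open import Data.Fin.Properties using (suc-injective)
open import Data.List.Base using (List; []; _∷_; _++_; map; filterᵇ)
open import Data.List.Membership.Propositional using (find; lose) renaming (_∈_ to _∈ˡ_)
open import Data.List.Membership.Propositional.Properties using (∈-map⁺; ∈-allFin; ∈-filter⁺; ∈-filter⁻)
open import Data.List.Properties using (map-∘; map-cong)
open import Data.List.Relation.Unary.All as All using (All; []; _∷_)
open import Data.List.Relation.Unary.All.Properties using (++⁻; ++⁺; map⁺; map⁻)
open import Data.List.Relation.Unary.Any using (Any; here; there)
open import Data.List.Relation.Unary.Any.Properties using () renaming (map⁺ to Any-map⁺; map⁻ to Any-map⁻)
open import Data.Nat.Base using (ℕ; zero; suc; s≤s; z≤n)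
open import Data.Product.Base using (Σ; ∃; ∃-syntax; _×_; _,_; proj₁; proj₂)
open import Data.Product.Function.NonDependent.Propositional using (_×-⇔_)
open import Data.Sum.Base using (_⊎_; inj₁; inj₂; [_,_]′)
open import Data.Unit.Base using (⊤; tt)
import Data.Vec.Base as Vec
open import Data.Vec.Base using (Vec; []; _∷_)
import Data.Vec.Properties as Vec
import Data.Vec.Relation.Unary.All as Allᵛ
open import Defs
open import Function.Base using (_∘_; id)
open import Function.Bundles using (Equivalence; Inverse; _↔_; mk⇔) renaming (_⇔_ to _⟷_)
open import Function.Construct.Composition using (_⇔-∘_)
open import Function.Construct.Identity using (⇔-id; ↔-id)
open import Function.Construct.Symmetry using (⇔-sym)
open import Function.Related.TypeIsomorphisms using (¬-cong-⇔)
open import Level using (0ℓ)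
open import Relation.Binary.Core using (Rel)
open import Relation.Binary.PropositionalEquality using (_≡_; _≢_; refl; sym; trans; cong; cong₂; subst; subst₂)
open import Relation.Binary.Structures using (IsEquivalence)
open import Relation.Nullary.Decidable using (Dec; yes; no; isYes; decidable-stable; toWitness; fromWitness)
open import Relation.Nullary.Negation using (¬_; contradiction)
open import Relation.Unary using (Pred; _∈_)

open Equivalence using (to; from)

-- The predicate symbols form an arbitrary type, so formulas cannot be enumerated and the maximal
-- extension needs choice. The obstacle in the model is that k-sight constrains every situation,
-- while `H` describes only the actual one: a situation that z considers possible might bring the
-- other variable within sight although it is out of sight at `σ₀`. What rules this out is that
-- uncertainty is itself expressed by modal formulas, to which K-Additivity applies. Few derivations
-- are built by hand: propositional steps are argued for an arbitrary truth predicate, modal ones in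
-- an arbitrary maximal theory, and `complete` turns membership in all theories into derivability.

T-antisym : ∀ {a b} → (T a → T b) → (T b → T a) → a ≡ b
T-antisym {false} {false} p q = refl
T-antisym {false} {true}  p q = ⊥-elim (q tt)
T-antisym {true}  {false} p q = ⊥-elim (p tt)
T-antisym {true}  {true}  p q = refl

T-not : ∀ {b} → T (not b) ⟷ (¬ T b)
T-not {false} = mk⇔ (λ _ ()) (λ _ → tt)
T-not {true}  = mk⇔ (λ ()) (λ ¬t → ¬t tt)

-- Zermelo's proof of the Teichmüller–Tukey lemma. Excluded middle for types
-- returns an inhabitant of every inhabited type, so it serves as the choice
-- function, and Bool-valued predicates keep the power set in Set.
module Tukey (em : ExcludedMiddle 0ℓ) (ext : Extensionality 0ℓ 0ℓ)
             {A : Set} (F : List A → Set) where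

  Subset : Set
  Subset = A → Bool

  infix 4 _⊑_
  _⊑_ : Subset → Subset → Set
  X ⊑ Y = ∀ {a} → T (X a) → T (Y a)

  ⊑-antisym : ∀ {X Y} → X ⊑ Y → Y ⊑ X → X ≡ Y
  ⊑-antisym p q = ext λ a → T-antisym p q

  subset : Pred A 0ℓ → Subset
  subset P a = isYes (em {P a})

  Admissible : Subset → Set
  Admissible X = ∀ l → All (T ∘ X) l → F l

  insert : A → Subset → Subset
  insert a X = subset λ b → b ≡ a ⊎ T (X b)

  ∈-insert : ∀ {a X} → T (insert a X a)
  ∈-insert = fromWitness {a? = em} (inj₁ refl)

  ⊑-insert : ∀ {a X} → X ⊑ insert a X
  ⊑-insert = fromWitness {a? = em} ∘ inj₂

  Extension : Subset → Set
  Extension X = Σ A λ a → ¬ T (X a) × Admissible (insert a X)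

  extend : ∀ {X} → Dec (Extension X) → Subset
  extend {X} (yes (a , _)) = insert a X
  extend {X} (no _)        = X

  step : Subset → Subset
  step X = extend {X} em

  ⊑-step : ∀ {X} → X ⊑ step X
  ⊑-step {X} with em {Extension X}
  ... | yes (a , _) = ⊑-insert {a} {X}
  ... | no _  = id

  step-admissible : ∀ {X} → Admissible X → Admissible (step X)
  step-admissible {X} h with em {Extension X}
  ... | yes (_ , _ , h′) = h′
  ... | no _             = h

  step-closed⇒maximal : ∀ {X} → step X ⊑ X → ∀ {a} → Admissible (insert a X) → T (X a)
  step-closed⇒maximal {X} p {a} h with em {T (X a)} | em {Extension X}
  ... | yes a∈X | _                = a∈X
  ... | no _    | yes (b , b∉X , _) = contradiction (p (∈-insert {b} {X})) b∉X
  ... | no a∉X  | no ¬e            = contradiction (a , a∉X , h) ¬e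

  module _ (S : Subset) (S-admissible : Admissible S) where

    ⋃ : (Subset → Bool) → Subset
    ⋃ 𝒰 = subset λ a → T (S a) ⊎ ∃ λ X → T (𝒰 X) × T (X a)

    ⋃⁻ : ∀ 𝒰 {a} → T (⋃ 𝒰 a) → T (S a) ⊎ ∃ λ X → T (𝒰 X) × T (X a)
    ⋃⁻ 𝒰 = toWitness {a? = em}

    ⊑-⋃ : ∀ {𝒰 X} → T (𝒰 X) → X ⊑ ⋃ 𝒰
    ⊑-⋃ X∈𝒰 a∈X = fromWitness {a? = em} (inj₂ (_ , X∈𝒰 , a∈X))

    -- Zermelo's tower as an inductive family. `sup` takes arbitrary unions, not only unions of
    -- chains, since `chain` later shows that any two stages are comparable. The union of the empty
    -- family is `S`, so no separate base stage is needed.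
    data Tower : Subset → Set where
      next : ∀ {X} → Tower X → Tower (step X)
      sup  : ∀ {𝒰} → (∀ {X} → T (𝒰 X) → Tower X) → Tower (⋃ 𝒰)

    S⊑ : ∀ {X} → Tower X → S ⊑ X
    S⊑ (next t) = ⊑-step ∘ S⊑ t
    S⊑ (sup _)  = fromWitness {a? = em} ∘ inj₁

    ⋃-least : ∀ {𝒰 Y} → S ⊑ Y → (∀ {X} → T (𝒰 X) → X ⊑ Y) → ⋃ 𝒰 ⊑ Y
    ⋃-least {𝒰} p q a∈ with ⋃⁻ 𝒰 a∈
    ... | inj₁ a∈S             = p a∈S
    ... | inj₂ (X , X∈𝒰 , a∈X) = q X∈𝒰 a∈X

    -- These are the extreme points in the usual proof of the Bourbaki-Witt theorem: a stage
    -- strictly inside `Y` has its successor inside `Y`.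
    Gap : Subset → Set
    Gap Y = ∀ {Z} → Tower Z → Z ⊑ Y → Z ≡ Y ⊎ step Z ⊑ Y

    compare : ∀ {X Y} → Tower Y → Gap Y → Tower X → X ⊑ Y ⊎ step Y ⊑ X
    compare tY gap (next tX) with compare tY gap tX
    ... | inj₂ q = inj₂ (⊑-step ∘ q)
    ... | inj₁ p with gap tX p
    ...   | inj₁ refl = inj₂ id
    ...   | inj₂ r    = inj₁ r
    compare {Y = Y} tY gap (sup {𝒰} f) with em {∃ λ X → T (𝒰 X) × step Y ⊑ X}
    ... | yes (X , X∈𝒰 , q) = inj₂ (⊑-⋃ X∈𝒰 ∘ q)
    ... | no ¬q = inj₁ (⋃-least (S⊑ tY) below)
      where
      below : ∀ {X} → T (𝒰 X) → X ⊑ Y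
      below {X} X∈𝒰 with compare tY gap (f X∈𝒰)
      ... | inj₁ p = p
      ... | inj₂ q = contradiction (X , X∈𝒰 , λ {a} → q {a}) ¬q

    -- Induction on `Y`. For a union, either some member contains `step Z`, or `compare` puts every
    -- member inside `Z`, so that the union equals `Z`.
    gap : ∀ {Y} → Tower Y → Gap Y
    gap (next tY) tZ p with compare tY (gap tY) tZ
    ... | inj₂ q = inj₁ (⊑-antisym p q)
    ... | inj₁ q with gap tY tZ q
    ...   | inj₁ refl = inj₂ id
    ...   | inj₂ r    = inj₂ (⊑-step ∘ r)
    gap (sup {𝒰} f) {Z} tZ p with em {∃ λ X → T (𝒰 X) × step Z ⊑ X}
    ... | yes (X , X∈𝒰 , q) = inj₂ (⊑-⋃ X∈𝒰 ∘ q)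
    ... | no ¬q = inj₁ (⊑-antisym p (⋃-least (S⊑ tZ) below))
      where
      below : ∀ {X} → T (𝒰 X) → X ⊑ Z
      below {X} X∈𝒰 with compare (f X∈𝒰) (gap (f X∈𝒰)) tZ
      ... | inj₂ q = q ∘ ⊑-step
      ... | inj₁ q with gap (f X∈𝒰) tZ q
      ...   | inj₁ refl = id
      ...   | inj₂ r    = contradiction (X , X∈𝒰 , λ {a} → r {a}) ¬q

    chain : ∀ {X Y} → Tower X → Tower Y → X ⊑ Y ⊎ Y ⊑ X
    chain tX tY with compare tY (gap tY) tX
    ... | inj₁ p = inj₁ p
    ... | inj₂ q = inj₂ (q ∘ ⊑-step)

    -- A chain collects finitely many elements of its union in a single member, which is how
    -- admissibility passes to unions. The first alternative is there because `𝒰` may be empty.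
    finite-part : ∀ {𝒰} → (∀ {X} → T (𝒰 X) → Tower X) → ∀ {l} → All (T ∘ ⋃ 𝒰) l →
                  All (T ∘ S) l ⊎ ∃ λ X → T (𝒰 X) × All (T ∘ X) l
    finite-part f []        = inj₁ []
    finite-part {𝒰} f (a∈ ∷ l⊆) with ⋃⁻ 𝒰 a∈ | finite-part f l⊆
    ... | inj₁ a∈S | inj₁ l⊆S = inj₁ (a∈S ∷ l⊆S)
    ... | inj₁ a∈S | inj₂ (X , X∈𝒰 , l⊆X) = inj₂ (X , X∈𝒰 , S⊑ (f X∈𝒰) a∈S ∷ l⊆X)
    ... | inj₂ (X , X∈𝒰 , a∈X) | inj₁ l⊆S = inj₂ (X , X∈𝒰 , a∈X ∷ All.map (S⊑ (f X∈𝒰)) l⊆S)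
    ... | inj₂ (X , X∈𝒰 , a∈X) | inj₂ (Y , Y∈𝒰 , l⊆Y) with chain (f X∈𝒰) (f Y∈𝒰)
    ...   | inj₁ p = inj₂ (Y , Y∈𝒰 , p a∈X ∷ l⊆Y)
    ...   | inj₂ q = inj₂ (X , X∈𝒰 , a∈X ∷ All.map q l⊆Y)

    Tower⇒Admissible : ∀ {X} → Tower X → Admissible X
    Tower⇒Admissible (next t) = step-admissible (Tower⇒Admissible t)
    Tower⇒Admissible (sup f) l l⊆ with finite-part f l⊆
    ... | inj₁ l⊆S             = S-admissible l l⊆S
    ... | inj₂ (X , X∈𝒰 , l⊆X) = Tower⇒Admissible (f X∈𝒰) l l⊆X

    maximal : ∃ λ X → S ⊑ X × Admissible X × (∀ {a} → Admissible (insert a X) → T (X a))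
    -- The union of all stages is itself a stage, so its `step` is one of the sets united and adds
    -- nothing.
    maximal = ⋃ 𝒰 , S⊑ top , Tower⇒Admissible top ,
              step-closed⇒maximal (⊑-⋃ {𝒰} (fromWitness {a? = em} (next top)))
      where
      𝒰 : Subset → Bool
      𝒰 X = isYes (em {Tower X})
      top : Tower (⋃ 𝒰)
      top = sup (toWitness {a? = em})

-- Quotients of finite sets

-- Recursion on `n`: `zero` either joins the class of a later element that `em` finds, or opens a
-- new class. The section `g` will supply the constants that represent the elements of the domain.
finite-quotient : ExcludedMiddle 0ℓ → ∀ n (_≈_ : Rel (Fin n) 0ℓ) → IsEquivalence _≈_ →
  ∃[ m ] Σ (Fin n → Fin m) λ f → Σ (Fin m → Fin n) λ g →
    (∀ i → f (g i) ≡ i) × (∀ i j → (f i ≡ f j) ⟷ (i ≈ j))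
finite-quotient em zero    _≈_ eq = 0 , id , id , (λ ()) , λ ()
finite-quotient em (suc n) _≈_ eq
  with finite-quotient em n (λ i j → suc i ≈ suc j)
         (record { refl = E.refl ; sym = E.sym ; trans = E.trans })
     | em {∃ λ j → zero ≈ suc j}
  where module E = IsEquivalence eq
... | m , f , g , fg , ker | yes (j , 0≈j) = m , f′ , suc ∘ g , fg , ker′
  where
  module E = IsEquivalence eq
  f′ : Fin (suc n) → Fin m
  f′ zero    = f j
  f′ (suc i) = f i
  ker′ : ∀ i i′ → (f′ i ≡ f′ i′) ⟷ (i ≈ i′)
  ker′ zero    zero     = mk⇔ (λ _ → E.refl) (λ _ → refl)
  ker′ zero    (suc i′) = mk⇔ (λ e → E.trans 0≈j (to (ker j i′) e))
                              (λ r → from (ker j i′) (E.trans (E.sym 0≈j) r))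
  ker′ (suc i) zero     = mk⇔ (λ e → E.trans (to (ker i j) e) (E.sym 0≈j))
                              (λ r → from (ker i j) (E.trans r 0≈j))
  ker′ (suc i) (suc i′) = ker i i′
... | m , f , g , fg , ker | no ¬0≈ = suc m , f′ , g′ , fg′ , ker′
  where
  module E = IsEquivalence eq
  f′ : Fin (suc n) → Fin (suc m)
  f′ zero    = zero
  f′ (suc i) = suc (f i)
  g′ : Fin (suc m) → Fin (suc n)
  g′ zero    = zero
  g′ (suc i) = suc (g i)
  fg′ : ∀ i → f′ (g′ i) ≡ i
  fg′ zero    = refl
  fg′ (suc i) = cong suc (fg i)
  ker′ : ∀ i i′ → (f′ i ≡ f′ i′) ⟷ (i ≈ i′)
  ker′ zero    zero     = mk⇔ (λ _ → E.refl) (λ _ → refl)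
  ker′ zero    (suc i′) = mk⇔ (λ ()) (λ r → contradiction (i′ , r) ¬0≈)
  ker′ (suc i) zero     = mk⇔ (λ ()) (λ r → contradiction (i , E.sym r) ¬0≈)
  ker′ (suc i) (suc i′) = mk⇔ (to (ker i i′) ∘ suc-injective) (cong suc ∘ from (ker i i′))

-- Truth predicates and maximal consistent theories

module Metatheory (em : ExcludedMiddle 0ℓ) (ext : Extensionality 0ℓ 0ℓ)
                  (V : Vocabulary) (k : ℕ) where

  open Vocabulary V
  open ELCR V

  stable : {A : Set} → ¬ ¬ A → A
  stable = decidable-stable em

  constants-complete : ∀ c → c ∈ˡ constants
  constants-complete c = subst (_∈ˡ constants) (Inverse.strictlyInverseʳ e c)
                               (∈-map⁺ (Inverse.from e) (∈-allFin _))
    where e = proj₂ cons-finite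

  terms-complete : ∀ t → t ∈ˡ terms
  terms-complete (con c) = there (there (∈-map⁺ con (constants-complete c)))
  terms-complete (var x) = here refl
  terms-complete (var y) = there (here refl)

  -- The behaviour shared by Boolean valuations, maximal consistent theories and satisfaction in a
  -- model; derived connectives are treated once for all three.
  record Interpretation {ℓ} (H : Formula ℓ → Set) : Set where
    field
      neg  : ∀ φ → H (~ φ) ⟷ (¬ H φ)
      conj : ∀ φ ψ → H (φ ∧ ψ) ⟷ (H φ × H ψ)

    imp : ∀ φ ψ → H (φ ⇒ ψ) ⟷ (H φ → H ψ)
    imp φ ψ = mk⇔
      (λ h a → stable λ ¬b → to (neg _) h (from (conj _ _) (a , from (neg _) ¬b)))
      (λ f → from (neg _) λ h → let a , ¬b = to (conj _ _) h in to (neg _) ¬b (f a))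

    disj : ∀ φ ψ → H (φ ∨ ψ) ⟷ (H φ ⊎ H ψ)
    disj φ ψ = mk⇔
      (λ h → stable λ ¬ab → to (neg _) h
        (from (conj _ _) (from (neg _) (¬ab ∘ inj₁) , from (neg _) (¬ab ∘ inj₂))))
      (λ ab → from (neg _) λ h → let ¬a , ¬b = to (conj _ _) h in
        [ to (neg _) ¬a , to (neg _) ¬b ]′ ab)

    bicond : ∀ φ ψ → H (φ ⇔ ψ) ⟷ (H φ ⟷ H ψ)
    bicond φ ψ = mk⇔
      (λ h → let p , q = to (conj _ _) h in mk⇔ (to (imp _ _) p) (to (imp _ _) q))
      (λ e → from (conj _ _) (from (imp _ _) (to e) , from (imp _ _) (from e)))

    falsum : ¬ H ⊥ᶠ
    falsum h = let a , ¬a = to (conj _ _) h in to (neg _) ¬a a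

    ⋀-All : ∀ l → H (⋀ l) ⟷ All H l
    ⋀-All []      = mk⇔ (λ _ → []) (λ _ → from (neg _) falsum)
    ⋀-All (φ ∷ l) = mk⇔
      (λ h → let a , b = to (conj _ _) h in a ∷ to (⋀-All l) b)
      (λ { (a ∷ b) → from (conj _ _) (a , from (⋀-All l) b) })

    ⋁-Any : ∀ l → H (⋁ l) ⟷ Any H l
    ⋁-Any []      = mk⇔ (⊥-elim ∘ falsum) (λ ())
    ⋁-Any (φ ∷ l) = mk⇔
      ([ here , there ∘ to (⋁-Any l) ]′ ∘ to (disj _ _))
      (λ { (here a) → from (disj _ _) (inj₁ a) ; (there b) → from (disj _ _) (inj₂ (from (⋁-Any l) b)) })

    module _ {A : Set} {as : List A} (complete : ∀ a → a ∈ˡ as) (f : A → Formula ℓ) where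

      ⋀-filter : ∀ p → H (⋀ (map f (filterᵇ p as))) ⟷ (∀ a → T (p a) → H (f a))
      ⋀-filter p = mk⇔
        (λ h a pa → All.lookup (map⁻ {f = f} (to (⋀-All _) h)) (∈-filter⁺ (T? ∘ p) (complete a) pa))
        (λ h → from (⋀-All _) (map⁺ (All.tabulate λ {a} a∈ →
                 h a (proj₂ (∈-filter⁻ (T? ∘ p) {xs = as} a∈)))))

      ⋁-map : H (⋁ (map f as)) ⟷ ∃ λ a → H (f a)
      ⋁-map = mk⇔
        (λ h → let a , _ , ha = find (Any-map⁻ {f = f} {xs = as} (to (⋁-Any _) h)) in a , ha)
        (λ (a , ha) → from (⋁-Any _) (Any-map⁺ (lose (complete a) ha)))

  module _ {H : L⁻ → Set} (𝓘 : Interpretation H) where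
    open Interpretation 𝓘

    eval⇔ : ∀ φ → T (eval (λ ψ → isYes (em {H ψ})) φ) ⟷ H φ
    eval⇔ (pred P ts) = mk⇔ (toWitness {a? = em}) (fromWitness {a? = em})
    eval⇔ (t ≐ u)     = mk⇔ (toWitness {a? = em}) (fromWitness {a? = em})
    eval⇔ (Kv z t)    = mk⇔ (toWitness {a? = em}) (fromWitness {a? = em})
    eval⇔ (K z α)     = mk⇔ (toWitness {a? = em}) (fromWitness {a? = em})
    eval⇔ (~ φ)       = mk⇔
      (λ h → from (neg φ) λ a → to T-not h (from (eval⇔ φ) a))
      (λ h → from T-not λ a → to (neg φ) h (to (eval⇔ φ) a))
    eval⇔ (φ ∧ ψ)     = mk⇔
      (λ h → let a , b = to T-∧ h in from (conj φ ψ) (to (eval⇔ φ) a , to (eval⇔ ψ) b))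
      (λ h → let a , b = to (conj φ ψ) h in from T-∧ (from (eval⇔ φ) a , from (eval⇔ ψ) b))

    tautology-holds : ∀ {φ} → Tautology φ → H φ
    tautology-holds {φ} taut = to (eval⇔ φ) (from T-≡ (taut _))

  -- What holds in every `Interpretation` holds for `T ∘ eval v`, hence under every valuation.
  -- Propositional derivations thus become ordinary proofs.
  tau : ∀ {φ} → (∀ {H} → Interpretation H → H φ) → k ⊢ φ
  tau h = Tau _ λ v → to T-≡ (h {T ∘ eval v} record { neg = λ _ → T-not ; conj = λ _ _ → T-∧ })

  tau-imp : ∀ {φ ψ} → (∀ {H} → Interpretation H → H φ → H ψ) → k ⊢ φ ⇒ ψ
  tau-imp h = tau λ 𝓘 → from (Interpretation.imp 𝓘 _ _) (h 𝓘)

  record Theory (H : L⁻ → Set) : Set where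
    field
      interpretation : Interpretation H
      theorem        : ∀ {φ} → k ⊢ φ → H φ
    open Interpretation interpretation public

    apply : ∀ {φ ψ} → k ⊢ φ ⇒ ψ → H φ → H ψ
    apply d = to (imp _ _) (theorem d)

  open Tukey em ext (λ l → ¬ (k ⊢ ⋀ l ⇒ ⊥ᶠ))

  module Lindenbaum (X : L⁻ → Bool)
    (consistent : ∀ l → All (T ∘ X) l → ¬ (k ⊢ ⋀ l ⇒ ⊥ᶠ))
    (maximum : ∀ {φ} → Admissible (insert φ X) → T (X φ)) where

    -- The deductive closure of `X`, not `X` itself, becomes the theory: closure under derivation is
    -- then immediate, and the maximality of `X` enters through negation.
    Derivable : L⁻ → Set
    Derivable φ = ∃ λ l → All (T ∘ X) l × (k ⊢ ⋀ l ⇒ φ)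

    derivable-imp : ∀ {φ ψ} → k ⊢ φ ⇒ ψ → Derivable φ → Derivable ψ
    derivable-imp {φ} {ψ} d (l , l⊆X , e) = l , l⊆X , MP _ _ (MP _ _ trans-taut e) d
      where
      trans-taut : k ⊢ (⋀ l ⇒ φ) ⇒ (φ ⇒ ψ) ⇒ (⋀ l ⇒ ψ)
      trans-taut = tau-imp λ 𝓘 p → let open Interpretation 𝓘 in
        from (imp _ _) λ q → from (imp _ _) λ a → to (imp _ _) q (to (imp _ _) p a)

    derivable-∧ : ∀ {φ ψ} → Derivable φ → Derivable ψ → Derivable (φ ∧ ψ)
    derivable-∧ {φ} {ψ} (l , l⊆X , d) (m , m⊆X , e) =
      l ++ m , ++⁺ l⊆X m⊆X , MP _ _ (MP _ _ pair-taut d) e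
      where
      pair-taut : k ⊢ (⋀ l ⇒ φ) ⇒ (⋀ m ⇒ ψ) ⇒ (⋀ (l ++ m) ⇒ φ ∧ ψ)
      pair-taut = tau-imp λ 𝓘 p → let open Interpretation 𝓘 in
        from (imp _ _) λ q → from (imp _ _) λ a →
        let b , c = ++⁻ l (to (⋀-All (l ++ m)) a) in
        from (conj _ _) (to (imp _ _) p (from (⋀-All l) b) , to (imp _ _) q (from (⋀-All m) c))

    theorem-derivable : ∀ {φ} → k ⊢ φ → Derivable φ
    theorem-derivable {φ} d = [] , [] , MP _ _ (tau-imp λ 𝓘 a → from (Interpretation.imp 𝓘 _ _) λ _ → a) d

    member-derivable : ∀ {φ} → T (X φ) → Derivable φ
    member-derivable {φ} φ∈X = φ ∷ [] , φ∈X ∷ [] , tau-imp λ 𝓘 a → proj₁ (to (Interpretation.conj 𝓘 _ _) a)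

    ⊥-underivable : ¬ Derivable ⊥ᶠ
    ⊥-underivable (l , l⊆X , d) = consistent l l⊆X d

    split : ∀ {φ} l → All (T ∘ insert φ X) l →
      ∃ λ l′ → All (T ∘ X) l′ × (∀ {H : L⁻ → Set} → H φ → All H l′ → All H l)
    split []      []       = [] , [] , λ _ _ → []
    split {φ} (ψ ∷ l) (ψ∈ ∷ l⊆) with toWitness {a? = em {ψ ≡ φ ⊎ T (X ψ)}} ψ∈ | split l l⊆
    ... | inj₁ refl | l′ , l′⊆X , h = l′ , l′⊆X , λ a as → a ∷ h a as
    ... | inj₂ ψ∈X  | l′ , l′⊆X , h = ψ ∷ l′ , ψ∈X ∷ l′⊆X , λ { a (b ∷ as) → b ∷ h a as }

    -- Were `~ φ` underivable, adding `φ` would be admissible, because a contradiction from `φ` and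
    -- finitely many members of `X` derives `~ φ` from those members. Maximality would then put `φ`
    -- into `X`.
    refute : ∀ {φ} → ¬ T (X φ) → Derivable (~ φ)
    refute {φ} φ∉X = stable λ ¬d → φ∉X (maximum λ l l⊆ d →
      let l′ , l′⊆X , h = split l l⊆ in
      ¬d (l′ , l′⊆X , MP _ _ (tau-imp λ 𝓘 a → let open Interpretation 𝓘 in
        from (imp _ _) λ b → from (neg _) λ c →
        falsum (to (imp _ _) a (from (⋀-All l) (h c (to (⋀-All l′) b))))) d))

    contradictory : ∀ {φ} → Derivable φ → ¬ Derivable (~ φ)
    contradictory d e = ⊥-underivable (derivable-imp
      (tau-imp λ 𝓘 h → let open Interpretation 𝓘 ; a , ¬a = to (conj _ _) h in
        ⊥-elim (to (neg _) ¬a a)) (derivable-∧ d e))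

    theory : Theory Derivable
    theory = record
      { interpretation = record
        { neg  = λ φ → mk⇔ (λ ¬a a → contradictory a ¬a)
                           (λ ¬d → refute (¬d ∘ member-derivable))
        ; conj = λ φ ψ → mk⇔
            (λ d → derivable-imp (tau-imp λ 𝓘 h → proj₁ (to (Interpretation.conj 𝓘 _ _) h)) d ,
                   derivable-imp (tau-imp λ 𝓘 h → proj₂ (to (Interpretation.conj 𝓘 _ _) h)) d)
            (λ (a , b) → derivable-∧ a b)
        }
      ; theorem = theorem-derivable
      }

  lindenbaum : ∀ Γ → Consistent k Γ → ∃ λ H → Theory H × (∀ φ → φ ∈ Γ → H φ)
  lindenbaum Γ consistent =
    let X , S⊑X , good , maximum = maximal (subset Γ) λ l l⊆Γ d →
          consistent (l , All.map (toWitness {a? = em}) l⊆Γ , d)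
    in Lindenbaum.Derivable X good maximum , Lindenbaum.theory X good maximum ,
       λ φ φ∈Γ → Lindenbaum.member-derivable X good maximum (S⊑X (fromWitness {a? = em} φ∈Γ))

  -- An underivable `χ` leaves `~ χ` consistent, and Lindenbaum's lemma provides a theory that
  -- refutes `χ`. Reasoning in an arbitrary theory can therefore replace explicit derivations.
  complete : ∀ {χ} → (∀ {H} → Theory H → H χ) → k ⊢ χ
  complete {χ} h = stable λ ⊬χ →
    let H , th , ~χ∈ = lindenbaum (_≡ ~ χ) λ (l , l≡ , d) →
          ⊬χ (MP _ _ (tau-imp λ 𝓘 p → let open Interpretation 𝓘 in
            stable λ ¬χ → falsum (to (imp _ _) p
              (from (⋀-All l) (All.map (λ { refl → from (neg _) ¬χ }) l≡)))) d)
    in to (Theory.neg th χ) (~χ∈ _ refl) (h th)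

  -- Satisfaction, substitution and distance in a model

  ⌜⋁⌝ : ∀ l → ⌜ ⋁ l ⌝ ≡ ⋁ (map ⌜_⌝ l)
  ⌜⋁⌝ []      = refl
  ⌜⋁⌝ (α ∷ l) = cong (⌜ α ⌝ ∨_) (⌜⋁⌝ l)

  -- Under `K` the distance formula has to be basic, whereas the k-sight axiom uses its epistemic
  -- copy; this identifies the two.
  ⌜D⌝ : ∀ n t u → ⌜ Dᶠ n t u ⌝ ≡ Dᶠ n t u
  ⌜D⌝ zero    t u = refl
  ⌜D⌝ (suc n) t u = cong₂ _∨_ (⌜D⌝ n t u) (trans (⌜⋁⌝ (map _ terms)) (cong ⋁
    (trans (sym (map-∘ terms)) (map-cong (λ v → cong (_∧ (Rᶠ v u ∨ Rᶠ u v)) (⌜D⌝ n t v)) terms))))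

  ⊨-interpretation : ∀ {ℓ} M σ → Interpretation {ℓ} (M , σ ⊨_)
  ⊨-interpretation M σ = record { neg = λ _ → ⇔-id _ ; conj = λ _ _ → ⇔-id _ }

  module _ (M : Model) where
    open Model M

    ⌜⌝-⊨ : ∀ {σ} α → (M , σ ⊨ ⌜ α ⌝) ⟷ (M , σ ⊨ α)
    ⌜⌝-⊨ (pred P ts) = ⇔-id _
    ⌜⌝-⊨ (t ≐ u)     = ⇔-id _
    ⌜⌝-⊨ (~ α)       = ¬-cong-⇔ (⌜⌝-⊨ α)
    ⌜⌝-⊨ (α ∧ β)     = ⌜⌝-⊨ α ×-⇔ ⌜⌝-⊨ β

    module _ {σ τ : Var → D} {t₁ t₂ : Term}
             (agree : ∀ t → value σ (replace t₁ t₂ t) ≡ value τ t) where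

      -- With two situations, one substitution lemma serves both A4, where `τ` is `σ`, and
      -- Knowledge-Ground, where an instance at `σ` has to express `α` at `τ`.
      [/]-⊨ : ∀ α → (M , σ ⊨ α [ t₁ / t₂ ]) ⟷ (M , τ ⊨ α)
      [/]-⊨ (pred P ts) = mk⇔ (subst (I P) eq) (subst (I P) (sym eq))
        where
        eq : Vec.map (value σ) (Vec.map (replace t₁ t₂) ts) ≡ Vec.map (value τ) ts
        eq = trans (sym (Vec.map-∘ _ _ ts)) (Vec.map-cong agree ts)
      [/]-⊨ (t ≐ u)     = mk⇔ (λ e → trans (sym (agree t)) (trans e (agree u)))
                              (λ e → trans (agree t) (trans e (sym (agree u))))
      [/]-⊨ (~ α)       = ¬-cong-⇔ ([/]-⊨ α)
      [/]-⊨ (α ∧ β)     = [/]-⊨ α ×-⇔ [/]-⊨ β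

    replace-var : ∀ {σ τ z z′ c} → z ≢ z′ → τ z ≡ σ z → τ z′ ≡ Iᶜ c →
                  ∀ t → value σ (replace (con c) (var z′) t) ≡ value τ t
    replace-var                 z≢z′ p q (con _) = refl
    replace-var {z = x} {z′ = x} z≢z′ p q (var _) = contradiction refl z≢z′
    replace-var {z = y} {z′ = y} z≢z′ p q (var _) = contradiction refl z≢z′
    replace-var {z = x} {z′ = y} z≢z′ p q (var x) = sym p
    replace-var {z = x} {z′ = y} z≢z′ p q (var y) = sym q
    replace-var {z = y} {z′ = x} z≢z′ p q (var x) = sym q
    replace-var {z = y} {z′ = x} z≢z′ p q (var y) = sym p

    module _ {ℓ : Language} {σ : Var → D} where
      open Interpretation (⊨-interpretation {ℓ} M σ)

      -- Intermediate points are terms on one side and elements on the other; the two match because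
      -- constants name every element.
      D⇔Near : ∀ n t u → (M , σ ⊨ Dᶠ {ℓ} n t u) ⟷ Near n (value σ t) (value σ u)
      D⇔Near zero    t u = mk⇔ sym sym
      D⇔Near (suc n) t u = mk⇔ into out
        where
        link : Term → Formula ℓ
        link v = Dᶠ n t v ∧ (Rᶠ v u ∨ Rᶠ u v)
        into : M , σ ⊨ Dᶠ {ℓ} (suc n) t u → Near (suc n) (value σ t) (value σ u)
        into h with to (disj (Dᶠ n t u) (⋁ (map link terms))) h
        ... | inj₁ a = inj₁ (to (D⇔Near n t u) a)
        ... | inj₂ b with to (⋁-map terms-complete link) b
        ...   | v , c , d = inj₂ (value σ v , to (D⇔Near n t v) c , to (disj (Rᶠ v u) (Rᶠ u v)) d)
        out : Near (suc n) (value σ t) (value σ u) → M , σ ⊨ Dᶠ {ℓ} (suc n) t u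
        out (inj₁ a) = from (disj (Dᶠ n t u) (⋁ (map link terms))) (inj₁ (from (D⇔Near n t u) a))
        out (inj₂ (d , a , b)) with named d
        ... | c , refl = from (disj (Dᶠ n t u) (⋁ (map link terms))) (inj₂
          (from (⋁-map terms-complete link)
            (con c , from (D⇔Near n t (con c)) a , from (disj (Rᶠ (con c) u) (Rᶠ u (con c))) b)))

  -- What z knows in every theory

  other : Var → Var
  other x = y
  other y = x

  ≢-other : ∀ z → z ≢ other z
  ≢-other x ()
  ≢-other y ()

  var-cases : ∀ z z′ → z′ ≡ z ⊎ z′ ≡ other z
  var-cases x x = inj₁ refl
  var-cases x y = inj₂ refl
  var-cases y x = inj₂ refl
  var-cases y y = inj₁ refl

  -- K-Additivity needs a nonempty antecedent; K z (~ β) and its negation both serve.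
  necessitation : ∀ z α → k ⊢ ⌜ α ⌝ → k ⊢ K z α
  necessitation z α d = complete by-cases
    where
    β : Lᴮ
    β = ⊤ᶠ
    weaken : ∀ φ → k ⊢ φ ⇒ ⌜ α ⌝
    weaken φ = complete λ th → let open Theory th in from (imp _ _) λ _ → theorem d
    by-cases : ∀ {H} → Theory H → H (K z α)
    by-cases {H} th = stable λ ¬h → ¬h (dual (from (neg _) (¬h ∘ direct)))
      where
      open Theory th
      direct : H (K z (~ β)) → H (K z α)
      direct h = apply (K-Additivity z (~ β ∷ []) [] (s≤s z≤n) α (weaken _))
                       (from (⋀-All (K z (~ β) ∷ [])) (h ∷ []))
      dual : H (⟨K⟩ z β) → H (K z α)
      dual h = apply (K-Additivity z [] (β ∷ []) (s≤s z≤n) α (weaken _))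
                     (from (⋀-All (⟨K⟩ z β ∷ [])) (h ∷ []))

  ⊢Kv-con : ∀ z c → k ⊢ Kv z (con c)
  ⊢Kv-con z c = complete λ th → let open Theory th in
    from (to (bicond _ _) (apply (De-Re-Knowledge z (con c) c) (theorem (A1 _))))
         (theorem (necessitation z (con c ≐ con c) (A1 _)))

  ⊢D-refl : ∀ n t → k ⊢ Dᶠ n t t
  ⊢D-refl zero    t = A1 t
  ⊢D-refl (suc n) t = complete λ th → let open Theory th in
    from (disj _ _) (inj₁ (theorem (⊢D-refl n t)))

  ⊢Kv-self : ∀ z → k ⊢ Kv z (var z)
  ⊢Kv-self z = MP _ _ (k-sight z (var z)) (⊢D-refl k (var z))

  TermsIn-all : ∀ α → TermsIn (λ _ → true) α
  TermsIn-all (pred P ts) = Allᵛ.universal (λ _ → tt) ts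
  TermsIn-all (t ≐ u)     = tt , tt
  TermsIn-all (~ α)       = TermsIn-all α
  TermsIn-all (α ∧ β)     = TermsIn-all α , TermsIn-all β

  module _ {H} (th : Theory H) (z : Var) where
    open Theory th

    -- Constants are rigid and z always sees itself, so the place of `other z` is all that z can be
    -- missing when Structure-Knowledge is applied with every term in `𝒯`.
    Kv-other⇒K : H (Kv z (var (other z))) → ∀ α → H ⌜ α ⌝ → H (K z α)
    Kv-other⇒K h α a = apply (Structure-Knowledge z (λ _ → true) α (TermsIn-all α))
      (from (conj _ _) (from (⋀-filter terms-complete (Kv z) (λ _ → true)) (λ t _ → known t) , a))
      where
      known : ∀ t → H (Kv z t)
      known (con c) = theorem (⊢Kv-con z c)
      known (var z′) with var-cases z z′
      ... | inj₁ refl = theorem (⊢Kv-self z)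
      ... | inj₂ refl = h

  -- If z knows neither β nor its negation, then z does not see other z. Since
  -- the antecedent is modal, K-Additivity makes this known to z; this rules out
  -- epistemically possible situations in which other z would be within sight.
  unsure⇒out-of-sight : ∀ z β →
    k ⊢ Modal z [] (β ∷ ~ β ∷ []) ⇒ K z (~ Dᶠ k (var z) (var (other z)))
  unsure⇒out-of-sight z β = K-Additivity z [] (β ∷ ~ β ∷ []) (s≤s z≤n) _
    (subst (λ φ → k ⊢ Modal z [] (β ∷ ~ β ∷ []) ⇒ ~ φ) (sym (⌜D⌝ k _ _)) (complete λ {H} th →
      let open Theory th in
      from (imp _ _) λ h → from (neg _) λ near →
        contradict th near (to (⋀-All (⟨K⟩ z β ∷ ⟨K⟩ z (~ β) ∷ [])) h)))
    where
    contradict : ∀ {H} → Theory H → H (Dᶠ k (var z) (var (other z))) →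
                 ¬ All H (⟨K⟩ z β ∷ ⟨K⟩ z (~ β) ∷ [])
    -- `⟨K⟩ z (~ β)` is `~ K z (~ ~ β)` by definition, hence the double negation.
    contradict {H} th near (p ∷ p′ ∷ []) = to (neg _) p (known (~ β) (stable λ h →
      to (neg _) p′ (known (~ ~ β) (from (neg _) h))))
      where
      open Theory th
      known : ∀ α → H ⌜ α ⌝ → H (K z α)
      known = Kv-other⇒K th z (apply (k-sight z _) near)

  -- The canonical model

  -- In a pointed model only the classes of the actual situation σ₀ matter. In
  -- the class of σ₀ under z the value of z is fixed, and other z ranges over
  -- the constants that the theory deems possible; all other classes are
  -- singletons.
  module Canonical {H} (th : Theory H) where
    open Theory th

    enumeration : Cons ↔ Fin (suc (proj₁ cons-finite))
    enumeration = proj₂ cons-finite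

    nth : Fin (suc (proj₁ cons-finite)) → Cons
    nth = Inverse.from enumeration

    ≐-trans : ∀ {t u v} → H (t ≐ u) → H (u ≐ v) → H (t ≐ v)
    ≐-trans p q = apply (A3 _ _ _) (from (conj _ _) (p , q))

    ≐-sym : ∀ {t u} → H (t ≐ u) → H (u ≐ t)
    ≐-sym = apply (A2 _ _)

    quotient = finite-quotient em _ (λ i j → H (con (nth i) ≐ con (nth j)))
      (record { refl = theorem (A1 _) ; sym = ≐-sym ; trans = ≐-trans })

    Domain : Set
    Domain = Fin (proj₁ quotient)

    class : Cons → Domain
    class c = proj₁ (proj₂ quotient) (Inverse.to enumeration c)

    repr : Domain → Cons
    repr d = nth (proj₁ (proj₂ (proj₂ quotient)) d)

    class-repr : ∀ d → class (repr d) ≡ d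
    class-repr d = trans (cong (proj₁ (proj₂ quotient)) (Inverse.strictlyInverseˡ enumeration _))
                         (proj₁ (proj₂ (proj₂ (proj₂ quotient))) d)

    class-≡ : ∀ c d → (class c ≡ class d) ⟷ H (con c ≐ con d)
    class-≡ c d = subst₂ (λ a b → (class c ≡ class d) ⟷ H (con a ≐ con b))
      (Inverse.strictlyInverseʳ enumeration c) (Inverse.strictlyInverseʳ enumeration d)
      (proj₂ (proj₂ (proj₂ (proj₂ quotient))) _ _)

    denoted : ∀ t → ∃ λ c → H (t ≐ con c)
    denoted (con c) = c , theorem (A1 _)
    denoted (var z) = to (⋁-map constants-complete (λ c → var z ≐ con c)) (theorem (At-Some-Where z))

    denotation : Term → Domain
    denotation t = class (proj₁ (denoted t))

    normal : Term → Term
    normal t = con (repr (denotation t))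

    normal-≐ : ∀ t → H (normal t ≐ t)
    normal-≐ t = ≐-trans (to (class-≡ _ _) (class-repr _)) (≐-sym (proj₂ (denoted t)))

    normal-idem : ∀ t → normal (normal t) ≡ normal t
    normal-idem t = cong (con ∘ repr) (class-repr _)

    -- A4 replaces all occurrences of a term at once, so the arguments of a
    -- predicate are normalised one term of the vocabulary at a time.
    normalise : List Term → Term → Term
    normalise []      t = t
    normalise (u ∷ l) t = replace (normal u) u (normalise l t)

    normalise-spec : ∀ l t → (normalise l t ≡ normal t) ⊎ (normalise l t ≡ t × ¬ t ∈ˡ l)
    normalise-spec []      t = inj₂ (refl , λ ())
    normalise-spec (u ∷ l) t with normalise l t ≟ᵗ u | normalise-spec l t
    -- The constant already put for `t` may itself be `u`; since `normal` is idempotent, replacing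
    -- it again is harmless.
    ... | yes refl | inj₁ e       = inj₁ (trans (cong normal e) (normal-idem t))
    ... | yes refl | inj₂ (e , _) = inj₁ (cong normal e)
    ... | no _     | inj₁ e       = inj₁ e
    ... | no ≢u    | inj₂ (e , ∉l) = inj₂ (e , λ { (here t≡u) → ≢u (trans e t≡u) ; (there ∈l) → ∉l ∈l })

    pred-normalise : ∀ {m} (P : PredSym m) ts l → H (pred P ts) ⟷ H (pred P (Vec.map (normalise l) ts))
    pred-normalise P ts []      = subst (λ us → H (pred P ts) ⟷ H (pred P us)) (sym (Vec.map-id ts)) (⇔-id _)
    pred-normalise P ts (u ∷ l) = subst (λ us → H (pred P ts) ⟷ H (pred P us)) (sym (Vec.map-∘ _ _ ts))
      (to (bicond _ _) (apply (A4 (normal u) u (pred P (Vec.map (normalise l) ts))) (normal-≐ u))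
       ⇔-∘ pred-normalise P ts l)

    pred-normal : ∀ {m} (P : PredSym m) ts → H (pred P ts) ⟷ H (pred P (Vec.map normal ts))
    pred-normal P ts = subst (λ us → H (pred P ts) ⟷ H (pred P us)) (Vec.map-cong complete-normal ts)
                             (pred-normalise P ts terms)
      where
      complete-normal : ∀ t → normalise terms t ≡ normal t
      complete-normal t with normalise-spec terms t
      ... | inj₁ e       = e
      ... | inj₂ (_ , ∉) = contradiction (terms-complete t) ∉

    ≐-denotation : ∀ t u → H (t ≐ u) ⟷ (denotation t ≡ denotation u)
    ≐-denotation t u = mk⇔
      (λ h → from (class-≡ _ _) (≐-trans (≐-sym (proj₂ (denoted t))) (≐-trans h (proj₂ (denoted u)))))
      (λ e → ≐-trans (proj₂ (denoted t)) (≐-trans (to (class-≡ _ _) e) (≐-sym (proj₂ (denoted u)))))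

    σ₀ : Var → Domain
    σ₀ z = denotation (var z)

    Possible : Var → (Var → Domain) → Set
    Possible z τ = τ z ≡ σ₀ z × ∃ λ c → τ (other z) ≡ class c × H (⟨K⟩ z (var (other z) ≐ con c))

    interpret : ∀ {m} → PredSym m → Pred (Vec Domain m) 0ℓ
    interpret P ds = H (pred P (Vec.map (con ∘ repr) ds))

    serial : ∀ d → ∃ λ e → interpret R (d ∷ e ∷ [])
    serial d =
      let c , h = to (⋁-map constants-complete (λ c → Rᶠ (con (repr d)) (con c)))
                     (theorem (Seriality (repr d)))
      in class c , subst (λ e → H (pred R (con (repr e) ∷ con (repr (class c)) ∷ []))) (class-repr d)
                     (to (pred-normal R _) h)

    inhabited⇒nonempty : ∀ {n} → Fin n → NonemptyFinite (Fin n)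
    inhabited⇒nonempty {suc n} _ = n , ↔-id _

    M : Model
    M = record
      { D         = Domain
      ; D-finite  = inhabited⇒nonempty (σ₀ x)
      ; I         = interpret
      ; R-serial  = serial
      ; Iᶜ        = class
      ; named     = λ d → repr d , class-repr d
      ; Sit       = λ _ → ⊤
      ; Sit-inhab = σ₀ , tt
      ; _∼[_]_    = λ τ z τ′ → τ ≡ τ′ ⊎ (Possible z τ × Possible z τ′)
      ; ∼-equiv   = λ z → record
        { refl  = inj₁ refl
        ; sym   = λ { (inj₁ e) → inj₁ (sym e) ; (inj₂ (p , q)) → inj₂ (q , p) }
        ; trans = λ { (inj₁ refl) r → r ; (inj₂ p) (inj₁ refl) → inj₂ p
                    ; (inj₂ (p , _)) (inj₂ (_ , q)) → inj₂ (p , q) }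
        }
      }

    open Model M using (value; Near; _∼[_]_)

    value-σ₀ : ∀ t → value σ₀ t ≡ denotation t
    value-σ₀ (con c) = refl
    value-σ₀ (var z) = refl

    ≐-truth : ∀ t u → (value σ₀ t ≡ value σ₀ u) ⟷ H (t ≐ u)
    ≐-truth t u = subst₂ (λ d e → (d ≡ e) ⟷ H (t ≐ u)) (sym (value-σ₀ t)) (sym (value-σ₀ u))
                         (⇔-sym (≐-denotation t u))

    pred-truth : ∀ {m} (P : PredSym m) ts → interpret P (Vec.map (value σ₀) ts) ⟷ H (pred P ts)
    pred-truth P ts = subst (λ us → H (pred P us) ⟷ H (pred P ts))
      (trans (Vec.map-cong (cong (con ∘ repr) ∘ sym ∘ value-σ₀) ts) (Vec.map-∘ _ _ ts))
      (⇔-sym (pred-normal P ts))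

    basic-truth : ∀ α → (M , σ₀ ⊨ α) ⟷ H ⌜ α ⌝
    basic-truth (pred P ts) = pred-truth P ts
    basic-truth (t ≐ u)     = ≐-truth t u
    basic-truth (~ α)       = ⇔-sym (neg _) ⇔-∘ ¬-cong-⇔ (basic-truth α)
    basic-truth (α ∧ β)     = ⇔-sym (conj _ _) ⇔-∘ (basic-truth α ×-⇔ basic-truth β)

    shift : Var → Domain → Var → Domain
    shift x d x = σ₀ x
    shift x d y = d
    shift y d x = d
    shift y d y = σ₀ y

    shift-at : ∀ z {d} → shift z d z ≡ σ₀ z × shift z d (other z) ≡ d
    shift-at x = refl , refl
    shift-at y = refl , refl

    -- With `𝒯` the constants that `H` deems possible, `Range` belongs to `H` by the very choice of
    -- `𝒯`. An instance of `α` at `σ₀` then says the same as `α` at the situation where `other z` is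
    -- moved to the class of the constant.
    K-possible : ∀ z α → H (K z α) ⟷ (∀ τ → Possible z τ → M , τ ⊨ α)
    K-possible z α = mk⇔ know learn
      where
      possible : Cons → Bool
      possible c = isYes (em {H (⟨K⟩ z (var (other z) ≐ con c))})

      range : H (Range z (other z) possible)
      range = from (conj _ _)
        ( from (⋀-filter constants-complete _ possible) (λ c → toWitness {a? = em})
        , from (⋀-filter constants-complete _ (not ∘ possible)) (λ c ¬p →
            stable λ ¬h → to T-not ¬p (fromWitness {a? = em} (from (neg _) ¬h))))

      ground : H (K z α) ⟷ (∀ c → T (possible c) → H ⌜ α [ con c / var (other z) ] ⌝)
      ground = ⋀-filter constants-complete _ possible ⇔-∘
               to (bicond _ _) (apply (Knowledge-Ground z (other z) (≢-other z) possible α) range)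

      at : ∀ {τ c} → τ z ≡ σ₀ z → τ (other z) ≡ class c →
           H ⌜ α [ con c / var (other z) ] ⌝ ⟷ (M , τ ⊨ α)
      at p q = [/]-⊨ M (replace-var M (≢-other z) p q) α ⇔-∘ ⇔-sym (basic-truth _)

      know : H (K z α) → ∀ τ → Possible z τ → M , τ ⊨ α
      know h τ (p , c , q , poss) = to (at p q) (to ground h c (fromWitness {a? = em} poss))

      learn : (∀ τ → Possible z τ → M , τ ⊨ α) → H (K z α)
      learn h = from ground λ c poss → let p , q = shift-at z in
        from (at p q) (h (shift z (class c)) (p , c , q , toWitness {a? = em} poss))

    -- By the T axiom, z cannot know that `other z` is not where it actually is.
    possible-σ₀ : ∀ z → Possible z σ₀
    possible-σ₀ z = refl , c , refl , from (neg _) λ h → to (neg _) (apply (T-axiom z _) h) z≐c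
      where
      c = proj₁ (denoted (var (other z)))
      z≐c = proj₂ (denoted (var (other z)))

    ∼σ₀⇒possible : ∀ {z τ} → τ ∼[ z ] σ₀ → Possible z τ
    ∼σ₀⇒possible (inj₁ refl)    = possible-σ₀ _
    ∼σ₀⇒possible (inj₂ (p , _)) = p

    K-truth : ∀ z α → (M , σ₀ ⊨ K z α) ⟷ H (K z α)
    K-truth z α = mk⇔ into out
      where
      into : M , σ₀ ⊨ K z α → H (K z α)
      into h = from (K-possible z α) λ τ p → h tt (inj₂ (p , possible-σ₀ z))
      out : H (K z α) → M , σ₀ ⊨ K z α
      out h _ r = to (K-possible z α) h _ (∼σ₀⇒possible r)

    Kv-truth : ∀ z t → (M , σ₀ ⊨ Kv z t) ⟷ H (Kv z t)
    Kv-truth z t = mk⇔ into out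
      where
      de-re : H (Kv z t) ⟷ H (K z (t ≐ con (proj₁ (denoted t))))
      de-re = to (bicond _ _) (apply (De-Re-Knowledge z t _) (proj₂ (denoted t)))
      into : M , σ₀ ⊨ Kv z t → H (Kv z t)
      into h = from de-re (from (K-possible z _) λ τ p →
        trans (h tt tt (inj₂ (p , possible-σ₀ z)) (inj₁ refl)) (value-σ₀ t))
      out : H (Kv z t) → M , σ₀ ⊨ Kv z t
      out h _ _ r r′ = let h′ = to (K-possible z _) (to de-re h) in
        trans (h′ _ (∼σ₀⇒possible r)) (sym (h′ _ (∼σ₀⇒possible r′)))

    truth : ∀ φ → (M , σ₀ ⊨ φ) ⟷ H φ
    truth (pred P ts) = pred-truth P ts
    truth (t ≐ u)     = ≐-truth t u
    truth (~ φ)       = ⇔-sym (neg _) ⇔-∘ ¬-cong-⇔ (truth φ)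
    truth (φ ∧ ψ)     = ⇔-sym (conj _ _) ⇔-∘ (truth φ ×-⇔ truth ψ)
    truth (Kv z t)    = Kv-truth z t
    truth (K z α)     = K-truth z α

    -- Both situations put z at its actual place. Let `τ` put `other z` at `c`. If z knows this in
    -- `H`, then `τ′` agrees; otherwise z is unsure of it, so z knows that `other z` is out of
    -- sight, which `τ` contradicts.
    sight : KSight k M
    sight z _ _ (inj₁ refl) z′ near = refl
    sight z {τ} {τ′} _ _ (inj₂ (p , p′)) z′ near with var-cases z z′
    ... | inj₁ refl = trans (proj₁ p) (sym (proj₁ p′))
    ... | inj₂ refl with p | em {H (K z (~ ~ (var (other z) ≐ con (proj₁ (proj₂ p)))))}
    ...   | _ , c , q , _    | yes h = trans q (sym (stable (to (K-possible z _) h τ′ p′)))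
    ...   | _ , c , _ , poss | no ¬h = contradiction
      (from (D⇔Near M k (var z) (var (other z))) near)
      (to (K-possible z _) (apply (unsure⇒out-of-sight z β) (from (⋀-All (⟨K⟩ z β ∷ ⟨K⟩ z (~ β) ∷ []))
        (poss ∷ from (neg _) ¬h ∷ []))) τ p)
      where
      β : Lᴮ
      β = var (other z) ≐ con c

  satisfiable : ∀ Γ → Consistent k Γ → Satisfiable k Γ
  satisfiable Γ consistent =
    let H , th , Γ⊆H = lindenbaum Γ consistent
        open Canonical th
    in M , sight , σ₀ , tt , λ φ φ∈Γ → from (truth φ) (Γ⊆H φ φ∈Γ)

  -- Soundness and compactness

  ⇒-intro : {A B : Set} → (A → B) → ¬ (A × ¬ B)
  ⇒-intro f (a , ¬b) = ¬b (f a)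

  ⇒-elim : {A B : Set} → ¬ (A × ¬ B) → A → B
  ⇒-elim h a = stable λ ¬b → h (a , ¬b)

  ⇔-intro : {A B : Set} → (A → B) → (B → A) → ¬ (A × ¬ B) × ¬ (B × ¬ A)
  ⇔-intro f g = ⇒-intro f , ⇒-intro g

  replace-≡ : ∀ M {σ t₁ t₂} → Model.value M σ t₁ ≡ Model.value M σ t₂ →
              ∀ t → Model.value M σ (replace t₁ t₂ t) ≡ Model.value M σ t
  replace-≡ M {t₂ = t₂} e t with t ≟ᵗ t₂
  ... | yes refl = e
  ... | no _     = refl

  module _ (M : Model) {σ τ : Var → Model.D M} {𝒯 : Term → Bool}
           (agree : ∀ t → T (𝒯 t) → Model.value M σ t ≡ Model.value M τ t) where
    open Model M

    map-agree : ∀ {m} {ts : Vec Term m} → Allᵛ.All (T ∘ 𝒯) ts →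
                Vec.map (value σ) ts ≡ Vec.map (value τ) ts
    map-agree Allᵛ.[]       = refl
    map-agree (t∈ Allᵛ.∷ p) = cong₂ _∷_ (agree _ t∈) (map-agree p)

    ⊨-agree : ∀ α → TermsIn 𝒯 α → (M , σ ⊨ α) ⟷ (M , τ ⊨ α)
    ⊨-agree (pred P ts) p       = mk⇔ (subst (I P) (map-agree p)) (subst (I P) (sym (map-agree p)))
    ⊨-agree (t ≐ u)     (p , q) = mk⇔ (λ e → trans (sym (agree t p)) (trans e (agree u q)))
                                      (λ e → trans (agree t p) (trans e (sym (agree u q))))
    ⊨-agree (~ α)       p       = ¬-cong-⇔ (⊨-agree α p)
    ⊨-agree (α ∧ β)     (p , q) = ⊨-agree α p ×-⇔ ⊨-agree β q

  -- `⟨K⟩` negates `K`, so `K` has to transfer in both directions. Two models are allowed because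
  -- K-Elimination changes the relation of z.
  Modal-transfer : ∀ {M M′ σ σ′} z αs βs →
    (∀ α → M , σ ⊨ K z α → M′ , σ′ ⊨ K z α) → (∀ α → M′ , σ′ ⊨ K z α → M , σ ⊨ K z α) →
    M , σ ⊨ Modal z αs βs → M′ , σ′ ⊨ Modal z αs βs
  Modal-transfer {M} {M′} {σ} {σ′} z αs βs f g h =
    let p , q = ++⁻ (map (K z) αs) (to (Interpretation.⋀-All (⊨-interpretation M σ) conjuncts) h) in
    from (Interpretation.⋀-All (⊨-interpretation M′ σ′) conjuncts)
      (++⁺ (map⁺ (All.map (λ {α} → f α) (map⁻ p)))
           (map⁺ (All.map (λ {β} → possible β) (map⁻ q))))
    where
    conjuncts : List L⁻
    conjuncts = map (K z) αs ++ map (⟨K⟩ z) βs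
    possible : ∀ β → M , σ ⊨ ⟨K⟩ z β → M′ , σ′ ⊨ ⟨K⟩ z β
    possible β p h = p (g (~ β) h)

  -- K-Elimination is sound because the antecedent only mentions the other
  -- variable: it survives when z is made to distinguish all situations.
  module Omniscient (M : Model) (z : Var) where
    open Model M

    Mᶻ : Model
    Mᶻ = record
      { D = D ; D-finite = D-finite ; I = I ; R-serial = R-serial ; Iᶜ = Iᶜ ; named = named
      ; Sit = Sit ; Sit-inhab = Sit-inhab
      ; _∼[_]_  = λ σ w τ → (w ≡ z × σ ≡ τ) ⊎ (w ≢ z × σ ∼[ w ] τ)
      ; ∼-equiv = λ w → let module E = IsEquivalence (∼-equiv w) in record
        { refl  = λ {σ} → reflexive w σ
        ; sym   = λ { (inj₁ (e , p)) → inj₁ (e , sym p)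
                    ; {σ} {τ} (inj₂ (n , r)) → inj₂ (n , E.sym {σ} {τ} r) }
        ; trans = λ { (inj₁ (e , refl)) s → s ; (inj₂ r) (inj₁ (e , refl)) → inj₂ r
                    ; {σ} {τ} {υ} (inj₂ (n , r)) (inj₂ (_ , s)) → inj₂ (n , E.trans {σ} {τ} {υ} r s) }
        }
      }
      where
      reflexive : ∀ w (σ : Σ (Var → D) Sit) →
                  (w ≡ z × proj₁ σ ≡ proj₁ σ) ⊎ (w ≢ z × proj₁ σ ∼[ w ] proj₁ σ)
      reflexive w σ with em {w ≡ z}
      ... | yes e = inj₁ (e , refl)
      ... | no n  = inj₂ (n , IsEquivalence.refl (∼-equiv w) {σ})

    Mᶻ-sight : KSight k M → KSight k Mᶻ
    Mᶻ-sight ks w σ∈ τ∈ (inj₁ (_ , refl)) z′ near = refl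
    Mᶻ-sight ks w σ∈ τ∈ (inj₂ (_ , r))    z′ near = ks w σ∈ τ∈ r z′ (same-Near k near)
      where
      same-Near : ∀ n {d e} → Model.Near Mᶻ n d e → Near n d e
      same-Near zero    p                  = p
      same-Near (suc n) (inj₁ p)           = inj₁ (same-Near n p)
      same-Near (suc n) (inj₂ (u , p , r)) = inj₂ (u , same-Near n p , r)

    Mᶻ-value : ∀ σ t → value σ t ≡ Model.value Mᶻ σ t
    Mᶻ-value σ (con c) = refl
    Mᶻ-value σ (var z) = refl

    Mᶻ-⊨ : ∀ {σ} (α : Lᴮ) → (M , σ ⊨ α) ⟷ (Mᶻ , σ ⊨ α)
    Mᶻ-⊨ {σ} (pred P ts) = subst (λ ds → (M , σ ⊨ pred {basic} P ts) ⟷ I P ds)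
                                 (Vec.map-cong (Mᶻ-value σ) ts) (⇔-id _)
    Mᶻ-⊨ {σ} (t ≐ u)     = subst₂ (λ d e → (value σ t ≡ value σ u) ⟷ (d ≡ e))
                                  (Mᶻ-value σ t) (Mᶻ-value σ u) (⇔-id _)
    Mᶻ-⊨ (~ α)       = ¬-cong-⇔ (Mᶻ-⊨ α)
    Mᶻ-⊨ (α ∧ β)     = Mᶻ-⊨ α ×-⇔ Mᶻ-⊨ β

    Mᶻ-⌜⌝ : ∀ {σ} α → (M , σ ⊨ ⌜ α ⌝) ⟷ (Mᶻ , σ ⊨ ⌜ α ⌝)
    Mᶻ-⌜⌝ α = ⇔-sym (⌜⌝-⊨ Mᶻ α) ⇔-∘ (Mᶻ-⊨ α ⇔-∘ ⌜⌝-⊨ M α)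

    K-other⁺ : ∀ {w σ} → w ≢ z → ∀ α → M , σ ⊨ K w α → Mᶻ , σ ⊨ K w α
    K-other⁺ n α h m (inj₁ (e , _)) = contradiction e n
    K-other⁺ n α h m (inj₂ (_ , r)) = to (Mᶻ-⊨ α) (h m r)

    K-other⁻ : ∀ {w σ} → w ≢ z → ∀ α → Mᶻ , σ ⊨ K w α → M , σ ⊨ K w α
    K-other⁻ n α h m r = from (Mᶻ-⊨ α) (h m (inj₂ (n , r)))

    K-self : ∀ {σ} α → M , σ ⊨ ⌜ α ⌝ → Mᶻ , σ ⊨ K z α
    K-self α a m (inj₁ (_ , refl)) = to (Mᶻ-⊨ α) (to (⌜⌝-⊨ M α) a)
    K-self α a m (inj₂ (n , _))    = contradiction refl n

  module _ {M : Model} (ks : KSight k M) {σ} (σ∈ : σ ∈ Model.Sit M) where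
    open Model M
    open Interpretation (⊨-interpretation {epistemic} M σ) using (⋁-map; ⋀-filter)

    ∼-refl : ∀ z → σ ∼[ z ] σ
    ∼-refl z = IsEquivalence.refl (∼-equiv z) {σ , σ∈}

    ∼-sym : ∀ z {τ} → τ ∈ Sit → τ ∼[ z ] σ → σ ∼[ z ] τ
    ∼-sym z τ∈ r = IsEquivalence.sym (∼-equiv z) {_ , τ∈} {_ , σ∈} r

    Near-refl : ∀ n d → Near n d d
    Near-refl zero    d = refl
    Near-refl (suc n) d = inj₁ (Near-refl n d)

    Range-Possible : ∀ z z′ 𝒯 → M , σ ⊨ Range z z′ 𝒯 → ∀ c →
      T (𝒯 c) ⟷ (∃ λ τ → τ ∈ Sit × τ ∼[ z ] σ × τ z′ ≡ Iᶜ c)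
    Range-Possible z z′ 𝒯 (p , q) c = mk⇔
      (λ c∈ → stable λ ¬e → to (⋀-filter constants-complete (λ c → ⟨K⟩ z (var z′ ≐ con c)) 𝒯) p c c∈
                (λ τ∈ r e → ¬e (_ , τ∈ , r , e)))
      (λ (τ , τ∈ , r , e) → decidable-stable (T? _) λ c∉ →
        to (⋀-filter constants-complete (λ c → K z (~ (var z′ ≐ con c))) (not ∘ 𝒯)) q
           c (from T-not c∉) τ∈ r e)

    -- Every position is within sight of itself, so the situations that z considers possible share
    -- the value of z; `α` at such a situation is therefore an instance of `α` at `σ`. Each value of
    -- `z′` has a constant to instantiate with.
    ground : ∀ z z′ → z ≢ z′ → ∀ 𝒯 α → M , σ ⊨ Range z z′ 𝒯 →
      (M , σ ⊨ K z α) ⟷ (M , σ ⊨ ⋀ (map (λ c → ⌜ α [ con c / var z′ ] ⌝) (filterᵇ 𝒯 constants)))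
    ground z z′ n 𝒯 α rng = mk⇔ into out
      where
      instances : L⁻
      instances = ⋀ (map (λ c → ⌜ α [ con c / var z′ ] ⌝) (filterᵇ 𝒯 constants))
      conjuncts = ⋀-filter constants-complete (λ c → ⌜ α [ con c / var z′ ] ⌝) 𝒯
      at : ∀ {τ c} → τ ∈ Sit → τ ∼[ z ] σ → τ z′ ≡ Iᶜ c →
           (M , σ ⊨ ⌜ α [ con c / var z′ ] ⌝) ⟷ (M , τ ⊨ α)
      at {c = c} τ∈ r e = [/]-⊨ M (replace-var M {σ} n same e) α ⇔-∘ ⌜⌝-⊨ M (α [ con c / var z′ ])
        where same = sym (ks z σ∈ τ∈ (∼-sym z τ∈ r) z (Near-refl k _))
      into : M , σ ⊨ K z α → M , σ ⊨ instances
      into h = from conjuncts λ c c∈ →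
        let τ , τ∈ , r , e = to (Range-Possible z z′ 𝒯 rng c) c∈ in from (at τ∈ r e) (h τ∈ r)
      out : M , σ ⊨ instances → M , σ ⊨ K z α
      out h {τ} τ∈ r with named (τ z′)
      ... | c , e = to (at τ∈ r (sym e))
                       (to conjuncts h c (from (Range-Possible z z′ 𝒯 rng c) (τ , τ∈ , r , sym e)))

    sees : ∀ z t → M , σ ⊨ Dᶠ {epistemic} k (var z) t → M , σ ⊨ Kv z t
    sees z (con c)  h _ _ _ _ = refl
    sees z (var z′) h τ∈ τ′∈ r r′ =
      trans (sym (ks z σ∈ τ∈ (∼-sym z τ∈ r) z′ near)) (ks z σ∈ τ′∈ (∼-sym z τ′∈ r′) z′ near)
      where
      near : Near k (σ z) (σ z′)
      near = to (D⇔Near M k (var z) (var z′)) h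

    de-re : ∀ z t c → value σ t ≡ Iᶜ c → (M , σ ⊨ Kv z t) ⟷ (M , σ ⊨ K z (t ≐ con c))
    de-re z t c e = mk⇔ into out
      where
      into : M , σ ⊨ Kv z t → M , σ ⊨ K z (t ≐ con c)
      into h τ∈ r = trans (h τ∈ σ∈ r (∼-refl z)) e
      out : M , σ ⊨ K z (t ≐ con c) → M , σ ⊨ Kv z t
      out h τ∈ τ′∈ r r′ = trans (h τ∈ r) (sym (h τ′∈ r′))

    structure : ∀ z 𝒯 α → TermsIn 𝒯 α → M , σ ⊨ KvAll z 𝒯 → M , σ ⊨ ⌜ α ⌝ → M , σ ⊨ K z α
    structure z 𝒯 α p h a τ∈ r = to (⊨-agree M {𝒯 = 𝒯} (λ t t∈ →
      to (⋀-filter terms-complete (Kv z) 𝒯) h t t∈ σ∈ τ∈ (∼-refl z) r) α p) (to (⌜⌝-⊨ M α) a)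

  -- Model and situation are quantified after the derivation, since K-Additivity uses its premise at
  -- another situation and K-Elimination in another model.
  sound : ∀ {φ} → k ⊢ φ → ∀ {M} → KSight k M → ∀ {σ} → σ ∈ Model.Sit M → M , σ ⊨ φ
  sound (Tau φ taut) {M} ks {σ} σ∈ = tautology-holds (⊨-interpretation M σ) {φ} taut
  sound (A1 t) ks σ∈ = refl
  sound (A2 t u) ks σ∈ = ⇒-intro sym
  sound (A3 t u v) ks σ∈ = ⇒-intro λ (p , q) → trans p q
  sound (A4 t u α) {M} ks σ∈ = ⇒-intro λ e →
    let h = ⇔-sym (⌜⌝-⊨ M (α [ t / u ])) ⇔-∘ (⇔-sym ([/]-⊨ M (replace-≡ M e) α) ⇔-∘ ⌜⌝-⊨ M α) in
    ⇔-intro (to h) (from h)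
  sound (MP φ ψ d e) ks σ∈ = ⇒-elim (sound d ks σ∈) (sound e ks σ∈)
  sound (Seriality c) {M} ks {σ} σ∈ =
    let open Model M ; e , r = R-serial (Iᶜ c) ; d , p = named e in
    from (Interpretation.⋁-map (⊨-interpretation M σ) constants-complete (λ t → Rᶠ (con c) (con t)))
         (d , subst (λ e → 𝐑 (Iᶜ c) e) (sym p) r)
  sound (At-Some-Where z) {M} ks {σ} σ∈ =
    let open Model M ; c , p = named (σ z) in
    from (Interpretation.⋁-map (⊨-interpretation M σ) constants-complete (λ c → var z ≐ con c))
         (c , sym p)
  sound (k-sight z t) ks σ∈ = ⇒-intro (sees ks σ∈ z t)
  sound (K-axiom z α β) {M} ks {σ} σ∈ = ⇒-intro {M , σ ⊨ K z (α ⇒ β)} λ f → ⇒-intro (distribute f)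
    where
    distribute : M , σ ⊨ K z (α ⇒ β) → M , σ ⊨ K z α → M , σ ⊨ K z β
    distribute f a τ∈ r = ⇒-elim (f τ∈ r) (a τ∈ r)
  sound (T-axiom z α) {M} ks {σ} σ∈ = ⇒-intro {M , σ ⊨ K z α} λ h →
    from (⌜⌝-⊨ M α) (h σ∈ (∼-refl {M} ks σ∈ z))
  sound (Knowledge-Ground z z′ n 𝒯 α) ks σ∈ = ⇒-intro λ rng →
    ⇔-intro (to (ground ks σ∈ z z′ n 𝒯 α rng)) (from (ground ks σ∈ z z′ n 𝒯 α rng))
  sound (K-Additivity z αs βs _ α d) {M} ks {σ} σ∈ = ⇒-intro know
    where
    open Model M
    know : M , σ ⊨ Modal z αs βs → M , σ ⊨ K z α
    know h {τ} τ∈ r = to (⌜⌝-⊨ M α) (⇒-elim (sound d ks τ∈) (Modal-transfer {M} {M} z αs βs forth back h))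
      where
      module E = IsEquivalence (∼-equiv z)
      forth : ∀ β → M , σ ⊨ K z β → M , τ ⊨ K z β
      forth β f υ∈ s = f υ∈ (E.trans {_ , υ∈} {_ , τ∈} {_ , σ∈} s r)
      back : ∀ β → M , τ ⊨ K z β → M , σ ⊨ K z β
      back β f υ∈ s = f υ∈ (E.trans {_ , υ∈} {_ , σ∈} {_ , τ∈} s (∼-sym {M} ks σ∈ z τ∈ r))
  sound (K-Elimination z z′ n αs βs _ α β d) {M} ks σ∈ = ⇒-intro λ h → ⇒-intro λ a →
    -- In `Mᶻ` the truth of `α` already gives `K z α`, so the premise applies there; `β` is basic
    -- and has the same truth value in `M`.
    from (Mᶻ-⌜⌝ β) (⇒-elim (⇒-elim (sound d (Mᶻ-sight ks) σ∈)
      (Modal-transfer {M} {Mᶻ} z′ αs βs (K-other⁺ (n ∘ sym)) (K-other⁻ (n ∘ sym)) h)) (K-self α a))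
    where open Omniscient M z
  sound (De-Re-Knowledge z t c) ks σ∈ = ⇒-intro λ e →
    ⇔-intro (to (de-re ks σ∈ z t c e)) (from (de-re ks σ∈ z t c e))
  sound (Structure-Knowledge z 𝒯 α p) ks σ∈ = ⇒-intro λ (h , a) → structure ks σ∈ z 𝒯 α p h a

  finitely-satisfiable⇒consistent : ∀ Γ → FinitelySatisfiable k Γ → Consistent k Γ
  finitely-satisfiable⇒consistent Γ fs (Γ₀ , Γ₀⊆Γ , d) =
    let M , ks , σ , σ∈ , h = fs Γ₀ Γ₀⊆Γ
        open Interpretation (⊨-interpretation {epistemic} M σ) in
    falsum (⇒-elim (sound d ks σ∈) (from (⋀-All Γ₀) (All.tabulate (h _))))

theorem2 : ExcludedMiddle 0ℓ → Extensionality 0ℓ 0ℓ →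
    (V : Vocabulary) (k : ℕ) → let open ELCR V in
    ((Γ : Pred L⁻ 0ℓ) → Consistent k Γ → Satisfiable k Γ) ×
    ((Γ : Pred L⁻ 0ℓ) → FinitelySatisfiable k Γ → Satisfiable k Γ)
theorem2 em ext V k = satisfiable , λ Γ fs → satisfiable Γ (finitely-satisfiable⇒consistent Γ fs)
  where open Metatheory em ext V k
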